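{- Let $b_1,\dots,b_m$ be distinct integers, $w_1,\dots,w_m>0$ real weights, $P(X)=\sum_{\ell=1}^m w_\ell X^{b_\ell}$, and $c=-\min_\ell b_\ell\ge1$. For $z\ne0$ in a neighbourhood of zero let $X_1,\dots,X_c$ be the $c$ small solutions of the characteristic equation $1-zP(X)=0$, and let $T(z)=\frac{1}{1-zP(1)}$. Then a family of solutions of the system of recurrence relations $$T_j(z)=1+z\sum_{\ell=1}^{m}w_\ell T_{j+b_\ell}(z),\qquad j\ge0,$$ well defined for $z\neq 0$ in a neighbourhood of zero, is given by $$T_j(z)=T(z)\Big(1-\sum_{\ell=1}^{c}\alpha_\ell X_\ell^j\Big),\qquad j\ge -c,$$ with free parameters $\alpha_\ell$, $1\le\ell\le c$. The parameters $\alpha_\ell$ are independent of $j$, but may depend on $X_1,\dots,X_c$ and $z$.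
   Context: For $z\neq0$ near zero, the characteristic equation $1-zP(X)=0$ has exactly $c$ solutions $X_1(z),\dots,X_c(z)$ that tend to $0$ as $z\to0$; these are called the small solutions. They satisfy $|X_\ell(z)|<1$ for $z$ near $0$, are nonzero, and are given near $0$ by $X_\ell(z)=\omega^{\ell-1}z^{1/c}A(\omega^{\ell-1}z^{1/c})$ with $\omega=e^{2\pi i/c}$ and $A$ analytic and nonzero at $0$. -}

module Defs where

open import Algebra.Bundles.Raw using (RawRing)
import Algebra.Definitions.RawSemiring as RawSemiringDefs
open import Data.Fin.Base using (Fin)
open import Data.Integer.Base as ℤ using (ℤ; +_; -[1+_])
open import Data.Nat.Base as ℕ using (ℕ; suc)
import Data.Nat.Properties as ℕ
open import Data.Product.Base using (Σ-syntax; ∃-syntax; _×_; _,_)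
open import Data.Rational.Base as ℚ using (ℚ; 0ℚ; 1ℚ; ½)
import Data.Rational.Properties as ℚ
open import Data.Rational.Solver using (module +-*-Solver)
open import Level using (0ℓ)
open import Relation.Binary.PropositionalEquality using (_≡_; _≢_; refl; sym; trans; cong; cong₂; subst)
open import Relation.Nullary.Decidable using (yes; no; toWitness)
open import Relation.Nullary.Negation using (contradiction)

IsCauchy : (ℕ → ℚ) → Set
IsCauchy x = ∀ ε → 0ℚ ℚ.< ε →
  ∃[ N ] (∀ i j → N ℕ.≤ i → N ℕ.≤ j → ℚ.∣ x i ℚ.- x j ∣ ℚ.< ε)

-- The reals are Cauchy sequences with a modulus, considered up to _≈ᴿ_.
record ℝ : Set where
  constructor mkℝ
  field
    seq    : ℕ → ℚ
    cauchy : IsCauchy seq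

open ℝ public

infix 4 _≈ᴿ_ _<ᴿ_

_≈ᴿ_ : ℝ → ℝ → Set
x ≈ᴿ y = ∀ ε → 0ℚ ℚ.< ε →
  ∃[ N ] (∀ n → N ℕ.≤ n → ℚ.∣ seq x n ℚ.- seq y n ∣ ℚ.< ε)

_<ᴿ_ : ℝ → ℝ → Set
x <ᴿ y = ∃[ δ ] 0ℚ ℚ.< δ ×
  ∃[ N ] (∀ n → N ℕ.≤ n → seq x n ℚ.+ δ ℚ.≤ seq y n)

-- Total inverse on ℚ, with 0 ⁻¹ = 0, so that inversion of a real acts
-- termwise on its sequence.
recip : ℚ → ℚ
recip q with q ℚ.≟ 0ℚ
... | yes _   = 0ℚ
... | no  q≢0 = ℚ.1/_ q ⦃ ℚ.≢-nonZero q≢0 ⦄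

private
  open module ℚ-≤-Reasoning = ℚ.≤-Reasoning

abstract

  private

    identity₁ : ∀ a b → a ≡ (a ℚ.- b) ℚ.+ b
    identity₁ = solve 2 (λ a b → a := (a :- b) :+ b) refl
      where open +-*-Solver

    identity₂ : ∀ a b c d → (a ℚ.+ b) ℚ.- (c ℚ.+ d) ≡ (a ℚ.- c) ℚ.+ (b ℚ.- d)
    identity₂ = solve 4 (λ a b c d → (a :+ b) :- (c :+ d) := (a :- c) :+ (b :- d)) refl
      where open +-*-Solver

    identity₃ : ∀ a b → (ℚ.- a) ℚ.- (ℚ.- b) ≡ ℚ.- (a ℚ.- b)
    identity₃ = solve 2 (λ a b → (:- a) :- (:- b) := :- (a :- b)) refl
      where open +-*-Solver

    identity₄ : ∀ a b c d →
      a ℚ.* b ℚ.- c ℚ.* d ≡ a ℚ.* (b ℚ.- d) ℚ.+ d ℚ.* (a ℚ.- c)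
    identity₄ = solve 4 (λ a b c d → a :* b :- c :* d := a :* (b :- d) :+ d :* (a :- c)) refl
      where open +-*-Solver

    identity₅ : ∀ a e r → a ℚ.* (e ℚ.* r) ≡ (a ℚ.* r) ℚ.* e
    identity₅ = solve 3 (λ a e r → a :* (e :* r) := (a :* r) :* e) refl
      where open +-*-Solver

    identity₆ : ∀ a b e d →
      (a ℚ.* b) ℚ.* (e ℚ.* (d ℚ.* d)) ≡ e ℚ.* ((d ℚ.* a) ℚ.* (d ℚ.* b))
    identity₆ = solve 4 (λ a b e d →
      (a :* b) :* (e :* (d :* d)) := e :* ((d :* a) :* (d :* b))) refl
      where open +-*-Solver

    identity₇ : ∀ a b c d →
      (a ℚ.* b) ℚ.* (d ℚ.- c) ≡ a ℚ.* (d ℚ.* b) ℚ.- b ℚ.* (c ℚ.* a)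
    identity₇ = solve 4 (λ a b c d →
      (a :* b) :* (d :- c) := a :* (d :* b) :- b :* (c :* a)) refl
      where open +-*-Solver

    recip-inverseʳ : ∀ q → 0ℚ ℚ.< q → q ℚ.* recip q ≡ 1ℚ
    recip-inverseʳ q 0<q with q ℚ.≟ 0ℚ
    ... | yes refl = contradiction 0<q (ℚ.<-irrefl refl)
    ... | no  q≢0  = ℚ.*-inverseʳ q ⦃ ℚ.≢-nonZero q≢0 ⦄

    recip-pos : ∀ q → 0ℚ ℚ.< q → 0ℚ ℚ.< recip q
    recip-pos q 0<q with q ℚ.≟ 0ℚ
    ... | yes refl = contradiction 0<q (ℚ.<-irrefl refl)
    ... | no  q≢0  = ℚ.positive⁻¹ _ ⦃ ℚ.1/pos⇒pos q ⦃ ℚ.positive 0<q ⦄ ⦄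

    *-pos : ∀ {p q} → 0ℚ ℚ.< p → 0ℚ ℚ.< q → 0ℚ ℚ.< p ℚ.* q
    *-pos {p} {q} 0<p 0<q =
      ℚ.positive⁻¹ _ ⦃ ℚ.pos*pos⇒pos p ⦃ ℚ.positive 0<p ⦄ q ⦃ ℚ.positive 0<q ⦄ ⦄

    *-mono-≤ : ∀ {p q r s} → 0ℚ ℚ.≤ r → 0ℚ ℚ.≤ q →
               p ℚ.≤ q → r ℚ.≤ s → p ℚ.* r ℚ.≤ q ℚ.* s
    *-mono-≤ {p} {q} {r} {s} 0≤r 0≤q p≤q r≤s = ℚ.≤-trans
      (ℚ.*-monoʳ-≤-nonNeg r ⦃ ℚ.nonNegative 0≤r ⦄ p≤q)
      (ℚ.*-monoˡ-≤-nonNeg q ⦃ ℚ.nonNegative 0≤q ⦄ r≤s)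

    0<½ : 0ℚ ℚ.< ½
    0<½ = toWitness {a? = 0ℚ ℚ.<? ½} _

    0<1 : 0ℚ ℚ.< 1ℚ
    0<1 = toWitness {a? = 0ℚ ℚ.<? 1ℚ} _

    halve : ∀ ε → 0ℚ ℚ.< ε → ∃[ η ] 0ℚ ℚ.< η × η ℚ.+ η ≡ ε
    halve ε 0<ε = ½ ℚ.* ε , *-pos 0<½ 0<ε ,
      trans (sym (ℚ.*-distribʳ-+ ε ½ ½)) (ℚ.*-identityˡ ε)

    shrink : ∀ A η → 0ℚ ℚ.< A → 0ℚ ℚ.< η →
      ∃[ θ ] 0ℚ ℚ.< θ × (∀ a d → ℚ.∣ a ∣ ℚ.≤ A → ℚ.∣ d ∣ ℚ.< θ → ℚ.∣ a ℚ.* d ∣ ℚ.< η)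
    shrink A η 0<A 0<η =
      η ℚ.* recip A , *-pos 0<η (recip-pos A 0<A) , λ a d a≤A d<θ → begin-strict
      ℚ.∣ a ℚ.* d ∣
        ≡⟨ ℚ.∣p*q∣≡∣p∣*∣q∣ a d ⟩
      ℚ.∣ a ∣ ℚ.* ℚ.∣ d ∣
        ≤⟨ ℚ.*-monoʳ-≤-nonNeg ℚ.∣ d ∣ ⦃ ℚ.nonNegative (ℚ.0≤∣p∣ d) ⦄ a≤A ⟩
      A ℚ.* ℚ.∣ d ∣
        <⟨ ℚ.*-monoʳ-<-pos A ⦃ ℚ.positive 0<A ⦄ d<θ ⟩
      A ℚ.* (η ℚ.* recip A)
        ≡⟨ identity₅ A η (recip A) ⟩
      A ℚ.* recip A ℚ.* η
        ≡⟨ cong (ℚ._* η) (recip-inverseʳ A 0<A) ⟩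
      1ℚ ℚ.* η
        ≡⟨ ℚ.*-identityˡ η ⟩
      η ∎

    maxˡ : ∀ {M N n} → M ℕ.⊔ N ℕ.≤ n → M ℕ.≤ n
    maxˡ {M} {N} = ℕ.≤-trans (ℕ.m≤m⊔n M N)

    maxʳ : ∀ {M N n} → M ℕ.⊔ N ℕ.≤ n → N ℕ.≤ n
    maxʳ {M} {N} = ℕ.≤-trans (ℕ.m≤n⊔m M N)

    bounded : ∀ x → IsCauchy x →
      ∃[ B ] 0ℚ ℚ.< B × ∃[ N ] (∀ n → N ℕ.≤ n → ℚ.∣ x n ∣ ℚ.≤ B)
    bounded x cx with cx 1ℚ 0<1
    ... | N , near = B , 0<B , N , bound
      where
      B : ℚ
      B = 1ℚ ℚ.+ ℚ.∣ x N ∣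
      0<B : 0ℚ ℚ.< B
      0<B = subst (ℚ._< B) (ℚ.+-identityʳ 0ℚ) (ℚ.+-mono-<-≤ 0<1 (ℚ.0≤∣p∣ (x N)))
      bound : ∀ n → N ℕ.≤ n → ℚ.∣ x n ∣ ℚ.≤ B
      bound n N≤n = begin
        ℚ.∣ x n ∣
          ≡⟨ cong ℚ.∣_∣ (identity₁ (x n) (x N)) ⟩
        ℚ.∣ (x n ℚ.- x N) ℚ.+ x N ∣
          ≤⟨ ℚ.∣p+q∣≤∣p∣+∣q∣ (x n ℚ.- x N) (x N) ⟩
        ℚ.∣ x n ℚ.- x N ∣ ℚ.+ ℚ.∣ x N ∣
          ≤⟨ ℚ.+-monoˡ-≤ ℚ.∣ x N ∣ (ℚ.<⇒≤ (near n N N≤n ℕ.≤-refl)) ⟩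
        B ∎

  const-cauchy : ∀ q → IsCauchy (λ _ → q)
  const-cauchy q ε 0<ε = 0 , λ _ _ _ _ →
    subst (λ d → ℚ.∣ d ∣ ℚ.< ε) (sym (ℚ.+-inverseʳ q)) 0<ε

  +-cauchy : ∀ x y → IsCauchy x → IsCauchy y → IsCauchy (λ n → x n ℚ.+ y n)
  +-cauchy x y cx cy ε 0<ε =
    let η , 0<η , η+η≡ε = halve ε 0<ε
        M , nearx = cx η 0<η
        N , neary = cy η 0<η
    in M ℕ.⊔ N , λ i j i≥ j≥ → begin-strict
    ℚ.∣ (x i ℚ.+ y i) ℚ.- (x j ℚ.+ y j) ∣
      ≡⟨ cong ℚ.∣_∣ (identity₂ (x i) (y i) (x j) (y j)) ⟩
    ℚ.∣ (x i ℚ.- x j) ℚ.+ (y i ℚ.- y j) ∣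
      ≤⟨ ℚ.∣p+q∣≤∣p∣+∣q∣ (x i ℚ.- x j) (y i ℚ.- y j) ⟩
    ℚ.∣ x i ℚ.- x j ∣ ℚ.+ ℚ.∣ y i ℚ.- y j ∣
      <⟨ ℚ.+-mono-< (nearx i j (maxˡ i≥) (maxˡ j≥)) (neary i j (maxʳ {M} i≥) (maxʳ {M} j≥)) ⟩
    η ℚ.+ η
      ≡⟨ η+η≡ε ⟩
    ε ∎

  neg-cauchy : ∀ x → IsCauchy x → IsCauchy (λ n → ℚ.- x n)
  neg-cauchy x cx ε 0<ε = let N , near = cx ε 0<ε in N , λ i j i≥ j≥ → begin-strict
    ℚ.∣ ℚ.- x i ℚ.- ℚ.- x j ∣
      ≡⟨ cong ℚ.∣_∣ (identity₃ (x i) (x j)) ⟩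
    ℚ.∣ ℚ.- (x i ℚ.- x j) ∣
      ≡⟨ ℚ.∣-p∣≡∣p∣ (x i ℚ.- x j) ⟩
    ℚ.∣ x i ℚ.- x j ∣
      <⟨ near i j i≥ j≥ ⟩
    ε ∎

  *-cauchy : ∀ x y → IsCauchy x → IsCauchy y → IsCauchy (λ n → x n ℚ.* y n)
  *-cauchy x y cx cy ε 0<ε =
    let η , 0<η , η+η≡ε   = halve ε 0<ε
        B , 0<B , K , x≤B = bounded x cx
        C , 0<C , L , y≤C = bounded y cy
        θ , 0<θ , scaleB  = shrink B η 0<B 0<η
        κ , 0<κ , scaleC  = shrink C η 0<C 0<η
        M , nearx         = cx κ 0<κ
        N , neary         = cy θ 0<θ
    in (K ℕ.⊔ L) ℕ.⊔ (M ℕ.⊔ N) , λ i j i≥ j≥ → begin-strict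
    ℚ.∣ x i ℚ.* y i ℚ.- x j ℚ.* y j ∣
      ≡⟨ cong ℚ.∣_∣ (identity₄ (x i) (y i) (x j) (y j)) ⟩
    ℚ.∣ x i ℚ.* (y i ℚ.- y j) ℚ.+ y j ℚ.* (x i ℚ.- x j) ∣
      ≤⟨ ℚ.∣p+q∣≤∣p∣+∣q∣ (x i ℚ.* (y i ℚ.- y j)) (y j ℚ.* (x i ℚ.- x j)) ⟩
    ℚ.∣ x i ℚ.* (y i ℚ.- y j) ∣ ℚ.+ ℚ.∣ y j ℚ.* (x i ℚ.- x j) ∣
      <⟨ ℚ.+-mono-<
           (scaleB (x i) (y i ℚ.- y j) (x≤B i (maxˡ {K} {L} (maxˡ i≥)))
             (neary i j (maxʳ {M} (maxʳ {K ℕ.⊔ L} i≥)) (maxʳ {M} (maxʳ {K ℕ.⊔ L} j≥))))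
           (scaleC (y j) (x i ℚ.- x j) (y≤C j (maxʳ {K} {L} (maxˡ j≥)))
             (nearx i j (maxˡ {M} (maxʳ {K ℕ.⊔ L} i≥)) (maxˡ {M} (maxʳ {K ℕ.⊔ L} j≥)))) ⟩
    η ℚ.+ η
      ≡⟨ η+η≡ε ⟩
    ε ∎

  recip-cauchy : ∀ x δ N → 0ℚ ℚ.< δ → (∀ n → N ℕ.≤ n → 0ℚ ℚ.+ δ ℚ.≤ x n) →
                 IsCauchy x → IsCauchy (λ n → recip (x n))
  recip-cauchy x δ N 0<δ δ≤x cx ε 0<ε =
    let M , near = cx (ε ℚ.* (δ ℚ.* δ)) (*-pos 0<ε (*-pos 0<δ 0<δ))
    in N ℕ.⊔ M , λ i j i≥ j≥ → begin-strict
    ℚ.∣ u i ℚ.- u j ∣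
      ≡⟨ cong ℚ.∣_∣ (difference i j (maxˡ i≥) (maxˡ j≥)) ⟩
    ℚ.∣ (u i ℚ.* u j) ℚ.* (x j ℚ.- x i) ∣
      ≡⟨ ℚ.∣p*q∣≡∣p∣*∣q∣ (u i ℚ.* u j) (x j ℚ.- x i) ⟩
    ℚ.∣ u i ℚ.* u j ∣ ℚ.* ℚ.∣ x j ℚ.- x i ∣
      ≡⟨ cong (ℚ._* ℚ.∣ x j ℚ.- x i ∣)
           (ℚ.0≤p⇒∣p∣≡p (ℚ.<⇒≤ (*-pos (0<u i (maxˡ i≥)) (0<u j (maxˡ j≥))))) ⟩
    (u i ℚ.* u j) ℚ.* ℚ.∣ x j ℚ.- x i ∣
      <⟨ ℚ.*-monoʳ-<-pos (u i ℚ.* u j)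
           ⦃ ℚ.positive (*-pos (0<u i (maxˡ i≥)) (0<u j (maxˡ j≥))) ⦄
           (near j i (maxʳ {N} j≥) (maxʳ {N} i≥)) ⟩
    (u i ℚ.* u j) ℚ.* (ε ℚ.* (δ ℚ.* δ))
      ≡⟨ identity₆ (u i) (u j) ε δ ⟩
    ε ℚ.* ((δ ℚ.* u i) ℚ.* (δ ℚ.* u j))
      ≤⟨ ℚ.*-monoˡ-≤-nonNeg ε ⦃ ℚ.nonNegative (ℚ.<⇒≤ 0<ε) ⦄
           (*-mono-≤ (ℚ.<⇒≤ (*-pos 0<δ (0<u j (maxˡ j≥)))) (ℚ.<⇒≤ 0<1)
             (δu≤1 i (maxˡ i≥)) (δu≤1 j (maxˡ j≥))) ⟩
    ε ℚ.* (1ℚ ℚ.* 1ℚ)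
      ≡⟨ ℚ.*-identityʳ ε ⟩
    ε ∎
    where
    u : ℕ → ℚ
    u n = recip (x n)
    δ≤ : ∀ n → N ℕ.≤ n → δ ℚ.≤ x n
    δ≤ n n≥ = subst (ℚ._≤ x n) (ℚ.+-identityˡ δ) (δ≤x n n≥)
    0<x : ∀ n → N ℕ.≤ n → 0ℚ ℚ.< x n
    0<x n n≥ = ℚ.<-≤-trans 0<δ (δ≤ n n≥)
    0<u : ∀ n → N ℕ.≤ n → 0ℚ ℚ.< u n
    0<u n n≥ = recip-pos (x n) (0<x n n≥)
    xu≡1 : ∀ n → N ℕ.≤ n → x n ℚ.* u n ≡ 1ℚ
    xu≡1 n n≥ = recip-inverseʳ (x n) (0<x n n≥)
    δu≤1 : ∀ n → N ℕ.≤ n → δ ℚ.* u n ℚ.≤ 1ℚ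
    δu≤1 n n≥ = subst (δ ℚ.* u n ℚ.≤_) (xu≡1 n n≥)
      (ℚ.*-monoʳ-≤-nonNeg (u n) ⦃ ℚ.nonNegative (ℚ.<⇒≤ (0<u n n≥)) ⦄ (δ≤ n n≥))
    difference : ∀ i j → N ℕ.≤ i → N ℕ.≤ j →
                 u i ℚ.- u j ≡ (u i ℚ.* u j) ℚ.* (x j ℚ.- x i)
    difference i j i≥ j≥ = sym (begin-equality
      (u i ℚ.* u j) ℚ.* (x j ℚ.- x i)
        ≡⟨ identity₇ (u i) (u j) (x i) (x j) ⟩
      u i ℚ.* (x j ℚ.* u j) ℚ.- u j ℚ.* (x i ℚ.* u i)
        ≡⟨ cong₂ (λ a b → u i ℚ.* a ℚ.- u j ℚ.* b) (xu≡1 j j≥) (xu≡1 i i≥) ⟩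
      u i ℚ.* 1ℚ ℚ.- u j ℚ.* 1ℚ
        ≡⟨ cong₂ ℚ._-_ (ℚ.*-identityʳ (u i)) (ℚ.*-identityʳ (u j)) ⟩
      u i ℚ.- u j ∎)

infixl 6 _+ᴿ_ _-ᴿ_
infixl 7 _*ᴿ_
infix  8 -ᴿ_

fromℚ : ℚ → ℝ
fromℚ q = mkℝ (λ _ → q) (const-cauchy q)

0ᴿ 1ᴿ : ℝ
0ᴿ = fromℚ 0ℚ
1ᴿ = fromℚ 1ℚ

_+ᴿ_ _*ᴿ_ : ℝ → ℝ → ℝ
x +ᴿ y = mkℝ (λ n → seq x n ℚ.+ seq y n) (+-cauchy (seq x) (seq y) (cauchy x) (cauchy y))
x *ᴿ y = mkℝ (λ n → seq x n ℚ.* seq y n) (*-cauchy (seq x) (seq y) (cauchy x) (cauchy y))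

-ᴿ_ : ℝ → ℝ
-ᴿ x = mkℝ (λ n → ℚ.- seq x n) (neg-cauchy (seq x) (cauchy x))

_-ᴿ_ : ℝ → ℝ → ℝ
x -ᴿ y = x +ᴿ (-ᴿ y)

invᴿ : (x : ℝ) → 0ᴿ <ᴿ x → ℝ
invᴿ x (δ , 0<δ , N , δ≤x) =
  mkℝ (λ n → recip (seq x n)) (recip-cauchy (seq x) δ N 0<δ δ≤x (cauchy x))

infix 6 _+i_

record ℂ : Set where
  constructor _+i_
  field
    re im : ℝ

open ℂ public

infix  4 _≈_ _#_ ∣_∣<_
infix  5 _#0
infixl 6 _+_ _-_
infixl 7 _*_
infix  8 -_

_≈_ : ℂ → ℂ → Set
x ≈ y = re x ≈ᴿ re y × im x ≈ᴿ im y

ofℝ : ℝ → ℂ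
ofℝ r = r +i 0ᴿ

0ℂ 1ℂ : ℂ
0ℂ = ofℝ 0ᴿ
1ℂ = ofℝ 1ᴿ

_+_ _*_ : ℂ → ℂ → ℂ
x + y = (re x +ᴿ re y) +i (im x +ᴿ im y)
x * y = (re x *ᴿ re y -ᴿ im x *ᴿ im y) +i (re x *ᴿ im y +ᴿ im x *ᴿ re y)

-_ : ℂ → ℂ
- x = (-ᴿ re x) +i (-ᴿ im x)

_-_ : ℂ → ℂ → ℂ
x - y = x + (- y)

normSq : ℂ → ℝ
normSq x = re x *ᴿ re x +ᴿ im x *ᴿ im x

-- |z| < ε, squared to avoid the square root; only used for ε > 0.
∣_∣<_ : ℂ → ℝ → Set
∣ z ∣< ε = normSq z <ᴿ ε *ᴿ ε

-- Being nonzero, in the positive form needed to invert.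
_#0 : ℂ → Set
z #0 = 0ᴿ <ᴿ normSq z

_#_ : ℂ → ℂ → Set
x # y = (x - y) #0

inv : (z : ℂ) → z #0 → ℂ
inv z z#0 = (re z *ᴿ r) +i ((-ᴿ im z) *ᴿ r)
  where r = invᴿ (normSq z) z#0

1#0 : 1ℂ #0
1#0 = 1ℚ , toWitness {a? = 0ℚ ℚ.<? 1ℚ} _ , 0 , λ _ _ → ℚ.≤-refl

ℂ-rawRing : RawRing 0ℓ 0ℓ
ℂ-rawRing = record
  { Carrier = ℂ ; _≈_ = _≈_ ; _+_ = _+_ ; _*_ = _*_ ; -_ = -_ ; 0# = 0ℂ ; 1# = 1ℂ }

open RawSemiringDefs (RawRing.rawSemiring ℂ-rawRing) public using (sum; _^_)

zpow : (x : ℂ) → x #0 → ℤ → ℂ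
zpow x x#0 (+ n)    = x ^ n
zpow x x#0 -[1+ n ] = inv x x#0 ^ suc n

record PuncturedDisc (ρ : ℝ) : Set where
  constructor point
  field
    value      : ℂ
    value#0    : value #0
    value-near : ∣ value ∣< ρ

open PuncturedDisc public

IsMin : ∀ {m} → (Fin m → ℤ) → ℤ → Set
IsMin b a = (∀ ℓ → a ℤ.≤ b ℓ) × ∃[ ℓ ] b ℓ ≡ a

module _ {m : ℕ} (b : Fin m → ℤ) (w : Fin m → ℝ) where

  P : (x : ℂ) → x #0 → ℂ
  P x x#0 = sum (λ ℓ → ofℝ (w ℓ) * zpow x x#0 (b ℓ))

  Solves : ℂ → (x : ℂ) → x #0 → Set
  Solves z x x#0 = 1ℂ - z * P x x#0 ≈ 0ℂ

  SolvesRecurrence : ℂ → (ℤ → ℂ) → Set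
  SolvesRecurrence z T = ∀ (j : ℕ) →
    T (+ j) ≈ 1ℂ + z * sum (λ ℓ → ofℝ (w ℓ) * T (+ j ℤ.+ b ℓ))

  -- X is a labelling of the small solutions over a punctured disc.  It is not
  -- required to be continuous in z: going around 0 permutes the branches.
  record SmallSolutions (c : ℕ) : Set where
    field
      radius      : ℝ
      radius>0    : 0ᴿ <ᴿ radius
      X           : PuncturedDisc radius → Fin c → ℂ
      X#0         : ∀ z ℓ → X z ℓ #0
      X-solves    : ∀ z ℓ → Solves (value z) (X z ℓ) (X#0 z ℓ)
      X-distinct  : ∀ z {k ℓ} → k ≢ ℓ → X z k # X z ℓ
      X-tendsTo-0 : ∀ ℓ η → 0ᴿ <ᴿ η → ∃[ δ ] 0ᴿ <ᴿ δ ×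
                      (∀ z → ∣ value z ∣< δ → ∣ X z ℓ ∣< η)
      -- Every solution branch tending to 0 is among X₁ … X_c: near z = 0, there
      -- is no further solution in a fixed neighbourhood of 0.
      X-exhaust   : ∃[ r ] 0ᴿ <ᴿ r × ∃[ δ ] 0ᴿ <ᴿ δ ×
                      (∀ z → ∣ value z ∣< δ →
                       ∀ x (x#0 : x #0) → ∣ x ∣< r → Solves (value z) x x#0 →
                       ∃[ ℓ ] x ≈ X z ℓ)

-- The constant sequence T(z) = 1/(1 - z P(1)) solves the recurrence, and X_k^j solves
-- its homogeneous part because z P(X_k) = 1; by linearity so does every combination.
-- The shifts j + b ℓ stay ≥ -c, where T is given by the closed form.
module Submission where

open import Algebra.Bundles using (CommutativeRing)
open import Algebra.Definitions using (Congruent₁; Congruent₂)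
open import Algebra.Structures using (IsCommutativeRing)
open import Data.Fin.Base using (Fin)
open import Data.Integer.Base as ℤ using (ℤ; +_; -[1+_])
import Data.Integer.Properties as ℤ
open import Data.Nat.Base as ℕ using (ℕ; zero; suc)
import Data.Nat.Properties as ℕ
open import Data.Product.Base using (Σ-syntax; ∃-syntax; _×_; _,_; proj₁; proj₂)
open import Data.Rational.Base as ℚ using (ℚ; 0ℚ; 1ℚ; ½)
import Data.Rational.Properties as ℚ
open import Data.Rational.Solver using (module +-*-Solver)
open import Data.Sum.Base using (inj₁; inj₂)
open import Function.Definitions using (Injective)
open import Level using (0ℓ)
open import Relation.Binary.Bundles using (Setoid)
open import Relation.Binary.PropositionalEquality as ≡ using (_≡_)
open import Relation.Binary.Structures using (IsEquivalence)
open import Relation.Nullary.Decidable using (yes; no; toWitness)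
open import Relation.Nullary.Negation using (contradiction)

-- Integer powers and the recurrence over an arbitrary commutative ring.

module CharacteristicRoots {a ℓ} (R : CommutativeRing a ℓ) where

  open CommutativeRing R
  open import Algebra.Properties.Group +-group using (//-rightDividesˡ; x∙y⁻¹≈ε⇒x≈y; ∙-cancelʳ)
  open import Algebra.Properties.Semiring.Exp semiring using (_^_; ^-homo-*)
  open import Algebra.Properties.Semiring.Sum semiring
    using (sum; sum-cong-≋; ∑-comm; ∑-distrib-+; *-distribˡ-sum)
  open import Algebra.Solver.Ring.NaturalCoefficients.Default commutativeSemiring
    using (solve; _:=_; _:+_; _:*_)
  open import Relation.Binary.Reasoning.Setoid setoid

  infixr 8 _^[_]_

  -- Integer powers of x, with y in the role of the inverse of x.
  _^[_]_ : Carrier → Carrier → ℤ → Carrier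
  x ^[ y ] + n      = x ^ n
  x ^[ y ] -[1+ n ] = y ^ suc n

  1^ : ∀ {x} → x ≈ 1# → ∀ n → x ^ n ≈ 1#
  1^ x≈1 zero    = refl
  1^ x≈1 (suc n) = trans (*-cong x≈1 (1^ x≈1 n)) (*-identityˡ 1#)

  1^[1] : ∀ {x y} → x ≈ 1# → y ≈ 1# → ∀ k → x ^[ y ] k ≈ 1#
  1^[1] x≈1 y≈1 (+ n)    = 1^ x≈1 n
  1^[1] x≈1 y≈1 -[1+ n ] = 1^ y≈1 (suc n)

  module _ {x y} (xy≈1 : x * y ≈ 1#) where

    -- The mixed-sign case of the exponent law. Each common successor that `m ⊖ n` sheds is matched
    -- by a factor `x * y`, which is 1.
    ^[]-⊖ : ∀ m n → x ^[ y ] (m ℤ.⊖ n) ≈ x ^ m * y ^ n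
    ^[]-⊖ m       zero    = sym (*-identityʳ (x ^ m))
    ^[]-⊖ zero    (suc n) = sym (*-identityˡ (y ^ suc n))
    ^[]-⊖ (suc m) (suc n) = begin
      x ^[ y ] (suc m ℤ.⊖ suc n)
        ≡⟨ ≡.cong (x ^[ y ]_) (ℤ.[1+m]⊖[1+n]≡m⊖n m n) ⟩
      x ^[ y ] (m ℤ.⊖ n)
        ≈⟨ ^[]-⊖ m n ⟩
      x ^ m * y ^ n
        ≈⟨ *-identityˡ (x ^ m * y ^ n) ⟨
      1# * (x ^ m * y ^ n)
        ≈⟨ *-congʳ xy≈1 ⟨
      x * y * (x ^ m * y ^ n)
        ≈⟨ solve 4 (λ x y p q → x :* y :* (p :* q) := x :* p :* (y :* q)) refl
             x y (x ^ m) (y ^ n) ⟩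
      x ^ suc m * y ^ suc n ∎

    -- The first exponent is a natural number because the recurrence only shifts by `j ≥ 0`. For
    -- negative `k` the sum of exponents computes to `m ⊖ suc n`.
    ^[]-homo-* : ∀ m k → x ^[ y ] (+ m ℤ.+ k) ≈ x ^ m * x ^[ y ] k
    ^[]-homo-* m (+ n)    = ^-homo-* x m n
    ^[]-homo-* m -[1+ n ] = ^[]-⊖ m (suc n)

  module _ {m c} (z p I : Carrier) (w u : Fin m → Carrier)
    (q : Fin c → Carrier) (e : Fin c → Fin m → Carrier) where

    private
      D Q : Carrier
      D = 1# - z * p
      Q = sum q
      S : Fin m → Carrier
      S ℓ = sum (λ k → q k * e k ℓ)

    -- In the application `q k` is `α k` times the `j`-th power of the `k`-th root, `e k ℓ` is the
    -- `b ℓ`-th power of that root, `u ℓ` is a power of 1, and `I` is the inverse of `D`. Thus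
    -- `I * (1# - Q)` is the closed form at `j` and `I * (1# - S ℓ)` the closed form at `j + b ℓ`.
    recurrence :
      p ≈ sum (λ ℓ → w ℓ * u ℓ) → (∀ ℓ → u ℓ ≈ 1#) → D * I ≈ 1# →
      (∀ k → 1# - z * sum (λ ℓ → w ℓ * e k ℓ) ≈ 0#) →
      I * (1# - Q) ≈ 1# + z * sum (λ ℓ → w ℓ * (I * (1# - S ℓ)))
    -- Adding `I * Q` turns the left side into `I`, that is `I * (D + z * p)`. The summand with `D`
    -- gives the inhomogeneous 1. Splitting `p` into `V + U`, the part `V` gives the sum on the
    -- right and the part `U` gives back `I * Q`.
    recurrence p≈ u≈1 DI≈1 char = ∙-cancelʳ (I * Q) _ _ (begin
      I * (1# - Q) + I * Q
        ≈⟨ distribˡ I (1# - Q) Q ⟨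
      I * (1# - Q + Q)
        ≈⟨ *-congˡ (//-rightDividesˡ Q 1#) ⟩
      I * 1#
        ≈⟨ *-congˡ (//-rightDividesˡ (z * p) 1#) ⟨
      I * (D + z * p)
        ≈⟨ *-congˡ (+-congˡ (*-congˡ p≈V+U)) ⟩
      I * (D + z * (V + U))
        ≈⟨ solve 5 (λ I D z V U → I :* (D :+ z :* (V :+ U)) :=
                     D :* I :+ z :* (I :* V) :+ I :* (z :* U)) refl I D z V U ⟩
      D * I + z * (I * V) + I * (z * U)
        ≈⟨ +-cong (+-cong DI≈1 (*-congˡ IV≈)) (*-congˡ zU≈Q) ⟩
      1# + z * sum (λ ℓ → w ℓ * (I * (1# - S ℓ))) + I * Q ∎)
      where
      U V : Carrier
      U = sum (λ ℓ → w ℓ * S ℓ)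
      V = sum (λ ℓ → w ℓ * (1# - S ℓ))

      -- Since powers of 1 are 1, `p` is the sum of the weights, and each weight splits along
      -- `1# = (1# - S ℓ) + S ℓ`.
      p≈V+U : p ≈ V + U
      p≈V+U = begin
        p
          ≈⟨ p≈ ⟩
        sum (λ ℓ → w ℓ * u ℓ)
          ≈⟨ sum-cong-≋ (λ ℓ → begin
               w ℓ * u ℓ                        ≈⟨ *-congˡ (u≈1 ℓ) ⟩
               w ℓ * 1#                         ≈⟨ *-congˡ (//-rightDividesˡ (S ℓ) 1#) ⟨
               w ℓ * (1# - S ℓ + S ℓ)           ≈⟨ distribˡ (w ℓ) (1# - S ℓ) (S ℓ) ⟩
               w ℓ * (1# - S ℓ) + w ℓ * S ℓ     ∎) ⟩
        sum (λ ℓ → w ℓ * (1# - S ℓ) + w ℓ * S ℓ)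
          ≈⟨ ∑-distrib-+ (λ ℓ → w ℓ * (1# - S ℓ)) (λ ℓ → w ℓ * S ℓ) ⟩
        V + U ∎

      IV≈ : I * V ≈ sum (λ ℓ → w ℓ * (I * (1# - S ℓ)))
      IV≈ = trans (*-distribˡ-sum I (λ ℓ → w ℓ * (1# - S ℓ)))
        (sum-cong-≋ (λ ℓ → solve 3 (λ I w s → I :* (w :* s) := w :* (I :* s)) refl
          I (w ℓ) (1# - S ℓ)))

      -- This is the homogeneous recurrence for the combination of roots. Exchanging the two sums
      -- isolates, for each `k`, the factor z P(X_k), which the characteristic equation makes 1.
      zU≈Q : z * U ≈ Q
      zU≈Q = begin
        z * sum (λ ℓ → w ℓ * S ℓ)
          ≈⟨ *-congˡ (sum-cong-≋ (λ ℓ → *-distribˡ-sum (w ℓ) (λ k → q k * e k ℓ))) ⟩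
        z * sum (λ ℓ → sum (λ k → w ℓ * (q k * e k ℓ)))
          ≈⟨ *-congˡ (∑-comm (λ ℓ k → w ℓ * (q k * e k ℓ))) ⟩
        z * sum (λ k → sum (λ ℓ → w ℓ * (q k * e k ℓ)))
          ≈⟨ *-distribˡ-sum z (λ k → sum (λ ℓ → w ℓ * (q k * e k ℓ))) ⟩
        sum (λ k → z * sum (λ ℓ → w ℓ * (q k * e k ℓ)))
          ≈⟨ sum-cong-≋ (λ k → begin
               z * sum (λ ℓ → w ℓ * (q k * e k ℓ))
                 ≈⟨ *-congˡ (sum-cong-≋ (λ ℓ →
                      solve 3 (λ w q e → w :* (q :* e) := q :* (w :* e)) refl
                        (w ℓ) (q k) (e k ℓ))) ⟩
               z * sum (λ ℓ → q k * (w ℓ * e k ℓ))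
                 ≈⟨ *-congˡ (*-distribˡ-sum (q k) (λ ℓ → w ℓ * e k ℓ)) ⟨
               z * (q k * sum (λ ℓ → w ℓ * e k ℓ))
                 ≈⟨ solve 3 (λ z q s → z :* (q :* s) := q :* (z :* s)) refl
                      z (q k) (sum (λ ℓ → w ℓ * e k ℓ)) ⟩
               q k * (z * sum (λ ℓ → w ℓ * e k ℓ))
                 ≈⟨ *-congˡ (x∙y⁻¹≈ε⇒x≈y 1# (z * sum (λ ℓ → w ℓ * e k ℓ)) (char k)) ⟨
               q k * 1#
                 ≈⟨ *-identityʳ (q k) ⟩
               q k ∎) ⟩
        sum q ∎

  module _ {m c} (z p I : Carrier) (w : Fin m → Carrier) (b : Fin m → ℤ)
    (α : Fin c → Carrier) (E : Fin c → ℤ → Carrier)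
    (E-homo : ∀ k j i → E k (+ j ℤ.+ i) ≈ E k (+ j) * E k i) where

    -- `T` is compared with the closed form exactly at the indices that the recurrence mentions.
    -- `E-homo` separates the dependence on `j` from that on `b ℓ`, which brings the sums at
    -- `j + b ℓ` into the form `S ℓ` of `recurrence`.
    recurrence-at : ∀ {u : Fin m → Carrier} (T : ℤ → Carrier) (j : ℕ) →
      let closed i = I * (1# - sum (λ k → α k * E k i)) in
      p ≈ sum (λ ℓ → w ℓ * u ℓ) → (∀ ℓ → u ℓ ≈ 1#) → (1# - z * p) * I ≈ 1# →
      (∀ k → 1# - z * sum (λ ℓ → w ℓ * E k (b ℓ)) ≈ 0#) →
      T (+ j) ≈ closed (+ j) → (∀ ℓ → T (+ j ℤ.+ b ℓ) ≈ closed (+ j ℤ.+ b ℓ)) →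
      T (+ j) ≈ 1# + z * sum (λ ℓ → w ℓ * T (+ j ℤ.+ b ℓ))
    recurrence-at {u} T j p≈ u≈1 DI≈1 char Tj Tjb = trans Tj (trans
      (recurrence z p I w u (λ k → α k * E k (+ j)) (λ k ℓ → E k (b ℓ)) p≈ u≈1 DI≈1 char)
      (+-congˡ (*-congˡ (sum-cong-≋ (λ ℓ → *-congˡ (sym (trans (Tjb ℓ)
        (*-congˡ (+-congˡ (-‿cong (sum-cong-≋ (λ k →
          trans (*-congˡ (E-homo k j (b ℓ)))
            (sym (*-assoc (α k) (E k (+ j)) (E k (b ℓ))))))))))))))))

open import Defs
open import Relation.Binary.PropositionalEquality using (refl; sym; trans; cong; subst)

private
  open module ℚ-≤-Reasoning = ℚ.≤-Reasoning

-- Rational arithmetic, null sequences and equality of reals.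

0<1 : 0ℚ ℚ.< 1ℚ
0<1 = toWitness {a? = 0ℚ ℚ.<? 1ℚ} _

0≤p*p : ∀ p → 0ℚ ℚ.≤ p ℚ.* p
0≤p*p p with ℚ.≤-total 0ℚ p
... | inj₁ 0≤p = ℚ.nonNegative⁻¹ _ ⦃ ℚ.nonNeg*nonNeg⇒nonNeg p ⦃ ℚ.nonNegative 0≤p ⦄ p ⦃ ℚ.nonNegative 0≤p ⦄ ⦄
... | inj₂ p≤0 = ℚ.nonNegative⁻¹ _ ⦃ ℚ.nonPos*nonPos⇒nonPos p ⦃ ℚ.nonPositive p≤0 ⦄ p ⦃ ℚ.nonPositive p≤0 ⦄ ⦄

*-pos : ∀ {p q} → 0ℚ ℚ.< p → 0ℚ ℚ.< q → 0ℚ ℚ.< p ℚ.* q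
*-pos {p} {q} 0<p 0<q =
  ℚ.positive⁻¹ _ ⦃ ℚ.pos*pos⇒pos p ⦃ ℚ.positive 0<p ⦄ q ⦃ ℚ.positive 0<q ⦄ ⦄

p*recip[p]≡1 : ∀ {p} → 0ℚ ℚ.< p → p ℚ.* recip p ≡ 1ℚ
p*recip[p]≡1 {p} 0<p with p ℚ.≟ 0ℚ
... | yes refl = contradiction 0<p (ℚ.<-irrefl refl)
... | no  p≢0  = ℚ.*-inverseʳ p ⦃ ℚ.≢-nonZero p≢0 ⦄

recip-pos : ∀ {p} → 0ℚ ℚ.< p → 0ℚ ℚ.< recip p
recip-pos {p} 0<p with p ℚ.≟ 0ℚ
... | yes refl = contradiction 0<p (ℚ.<-irrefl refl)
... | no  p≢0  = ℚ.positive⁻¹ _ ⦃ ℚ.1/pos⇒pos p ⦃ ℚ.positive 0<p ⦄ ⦄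

-- `x ≈ᴿ y` is by definition `IsNull` of the termwise difference, so symmetry, transitivity and the
-- congruences for `≈ᴿ` all come from closure properties of null sequences.
IsNull : (ℕ → ℚ) → Set
IsNull s = ∀ ε → 0ℚ ℚ.< ε → ∃[ N ] (∀ n → N ℕ.≤ n → ℚ.∣ s n ∣ ℚ.< ε)

null-resp : ∀ {s t} → (∀ n → s n ≡ t n) → IsNull s → IsNull t
null-resp s≡t s↓0 ε 0<ε = let N , near = s↓0 ε 0<ε in
  N , λ n n≥N → subst (λ q → ℚ.∣ q ∣ ℚ.< ε) (s≡t n) (near n n≥N)

eventually-0⇒null : ∀ {s} N → (∀ n → N ℕ.≤ n → s n ≡ 0ℚ) → IsNull s
eventually-0⇒null N s≡0 ε 0<ε =
  N , λ n n≥N → subst (λ q → ℚ.∣ q ∣ ℚ.< ε) (sym (s≡0 n n≥N)) 0<ε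

null-+ : ∀ {s t} → IsNull s → IsNull t → IsNull (λ n → s n ℚ.+ t n)
null-+ {s} {t} s↓0 t↓0 ε 0<ε =
  let 0<½ε     = *-pos (toWitness {a? = 0ℚ ℚ.<? ½} _) 0<ε
      M , nears = s↓0 (½ ℚ.* ε) 0<½ε
      N , neart = t↓0 (½ ℚ.* ε) 0<½ε
  in M ℕ.⊔ N , λ n n≥ → begin-strict
  ℚ.∣ s n ℚ.+ t n ∣
    ≤⟨ ℚ.∣p+q∣≤∣p∣+∣q∣ (s n) (t n) ⟩
  ℚ.∣ s n ∣ ℚ.+ ℚ.∣ t n ∣
    <⟨ ℚ.+-mono-< (nears n (ℕ.m⊔n≤o⇒m≤o M N n≥)) (neart n (ℕ.m⊔n≤o⇒n≤o M N n≥)) ⟩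
  ½ ℚ.* ε ℚ.+ ½ ℚ.* ε
    ≡⟨ ℚ.*-distribʳ-+ ε ½ ½ ⟨
  1ℚ ℚ.* ε
    ≡⟨ ℚ.*-identityˡ ε ⟩
  ε ∎

-- From the Cauchy index for 1 on, all terms lie within 1 of `seq x N`. The bound is at least 1, so
-- that it can be inverted and so that `1-zp#0` gets a radius of at most ½.
bounded : ∀ (x : ℝ) → ∃[ B ] 1ℚ ℚ.≤ B × ∃[ N ] (∀ n → N ℕ.≤ n → ℚ.∣ seq x n ∣ ℚ.≤ B)
bounded x = let N , near = cauchy x 1ℚ 0<1 in
  1ℚ ℚ.+ ℚ.∣ seq x N ∣ ,
  subst (ℚ._≤ 1ℚ ℚ.+ ℚ.∣ seq x N ∣) (ℚ.+-identityʳ 1ℚ) (ℚ.+-monoʳ-≤ 1ℚ (ℚ.0≤∣p∣ (seq x N))) ,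
  N , λ n n≥N → begin
  ℚ.∣ seq x n ∣
    ≡⟨ cong ℚ.∣_∣ (solve 2 (λ a b → a := (a :- b) :+ b) refl (seq x n) (seq x N)) ⟩
  ℚ.∣ (seq x n ℚ.- seq x N) ℚ.+ seq x N ∣
    ≤⟨ ℚ.∣p+q∣≤∣p∣+∣q∣ (seq x n ℚ.- seq x N) (seq x N) ⟩
  ℚ.∣ seq x n ℚ.- seq x N ∣ ℚ.+ ℚ.∣ seq x N ∣
    ≤⟨ ℚ.+-monoˡ-≤ ℚ.∣ seq x N ∣ (ℚ.<⇒≤ (near n N n≥N ℕ.≤-refl)) ⟩
  1ℚ ℚ.+ ℚ.∣ seq x N ∣ ∎
  where open +-*-Solver

-- With an eventual bound `B` on `x`, it suffices that `s` falls below ε / B. The constant sequence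
-- -1 as `x` serves for negation and symmetry.
null-scale : ∀ (x : ℝ) {s} → IsNull s → IsNull (λ n → seq x n ℚ.* s n)
null-scale x {s} s↓0 ε 0<ε =
  let B , 1≤B , M , x≤B = bounded x
      0<B      = ℚ.<-≤-trans 0<1 1≤B
      N , near = s↓0 (ε ℚ.* recip B) (*-pos 0<ε (recip-pos 0<B))
  in M ℕ.⊔ N , λ n n≥ → begin-strict
  ℚ.∣ seq x n ℚ.* s n ∣
    ≡⟨ ℚ.∣p*q∣≡∣p∣*∣q∣ (seq x n) (s n) ⟩
  ℚ.∣ seq x n ∣ ℚ.* ℚ.∣ s n ∣
    ≤⟨ ℚ.*-monoʳ-≤-nonNeg ℚ.∣ s n ∣ ⦃ ℚ.nonNegative (ℚ.0≤∣p∣ (s n)) ⦄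
         (x≤B n (ℕ.m⊔n≤o⇒m≤o M N n≥)) ⟩
  B ℚ.* ℚ.∣ s n ∣
    <⟨ ℚ.*-monoʳ-<-pos B ⦃ ℚ.positive 0<B ⦄ (near n (ℕ.m⊔n≤o⇒n≤o M N n≥)) ⟩
  B ℚ.* (ε ℚ.* recip B)
    ≡⟨ solve 3 (λ b e r → b :* (e :* r) := e :* (b :* r)) refl B ε (recip B) ⟩
  ε ℚ.* (B ℚ.* recip B)
    ≡⟨ cong (ε ℚ.*_) (p*recip[p]≡1 0<B) ⟩
  ε ℚ.* 1ℚ
    ≡⟨ ℚ.*-identityʳ ε ⟩
  ε ∎
  where open +-*-Solver

-- Leaving finitely many terms free is what inverses call for: a termwise reciprocal is controlled
-- only from the index where positivity is witnessed.
≈ᴿ-eventually : ∀ (x y : ℝ) N → (∀ n → N ℕ.≤ n → seq x n ≡ seq y n) → x ≈ᴿ y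
≈ᴿ-eventually x y N x≡y = eventually-0⇒null N (λ n n≥N →
  trans (cong (ℚ._- seq y n) (x≡y n n≥N)) (ℚ.+-inverseʳ (seq y n)))

≈ᴿ-termwise : ∀ (x y : ℝ) → (∀ n → seq x n ≡ seq y n) → x ≈ᴿ y
≈ᴿ-termwise x y x≡y = ≈ᴿ-eventually x y 0 (λ n _ → x≡y n)

+ᴿ-cong : ∀ x x′ y y′ → x ≈ᴿ x′ → y ≈ᴿ y′ → x +ᴿ y ≈ᴿ x′ +ᴿ y′
+ᴿ-cong x x′ y y′ x≈x′ y≈y′ = null-resp
  (λ n → solve 4 (λ a a′ b b′ → (a :- a′) :+ (b :- b′) := (a :+ b) :- (a′ :+ b′)) refl
    (seq x n) (seq x′ n) (seq y n) (seq y′ n))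
  (null-+ x≈x′ y≈y′)
  where open +-*-Solver

*ᴿ-cong : ∀ x x′ y y′ → x ≈ᴿ x′ → y ≈ᴿ y′ → x *ᴿ y ≈ᴿ x′ *ᴿ y′
*ᴿ-cong x x′ y y′ x≈x′ y≈y′ = null-resp
  (λ n → solve 4 (λ a a′ b b′ →
      a :* (b :- b′) :+ b′ :* (a :- a′) := a :* b :- a′ :* b′) refl
    (seq x n) (seq x′ n) (seq y n) (seq y′ n))
  (null-+ (null-scale x y≈y′) (null-scale y′ x≈x′))
  where open +-*-Solver

-ᴿ-cong : ∀ x x′ → x ≈ᴿ x′ → -ᴿ x ≈ᴿ -ᴿ x′
-ᴿ-cong x x′ x≈x′ = null-resp
  (λ n → solve 2 (λ a a′ → con (ℚ.- 1ℚ) :* (a :- a′) := (:- a) :- (:- a′)) refl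
    (seq x n) (seq x′ n))
  (null-scale (fromℚ (ℚ.- 1ℚ)) x≈x′)
  where open +-*-Solver

≈ᴿ-sym : ∀ x y → x ≈ᴿ y → y ≈ᴿ x
≈ᴿ-sym x y x≈y = null-resp
  (λ n → solve 2 (λ a b → con (ℚ.- 1ℚ) :* (a :- b) := b :- a) refl (seq x n) (seq y n))
  (null-scale (fromℚ (ℚ.- 1ℚ)) x≈y)
  where open +-*-Solver

≈ᴿ-trans : ∀ x y z → x ≈ᴿ y → y ≈ᴿ z → x ≈ᴿ z
≈ᴿ-trans x y z x≈y y≈z = null-resp
  (λ n → solve 3 (λ a b c → (a :- b) :+ (b :- c) := a :- c) refl
    (seq x n) (seq y n) (seq z n))
  (null-+ x≈y y≈z)
  where open +-*-Solver

-- The commutative ring of complex numbers.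

≈-termwise : ∀ (x y : ℂ) → (∀ n → seq (re x) n ≡ seq (re y) n) →
             (∀ n → seq (im x) n ≡ seq (im y) n) → x ≈ y
≈-termwise x y re≡ im≡ =
  ≈ᴿ-termwise (re x) (re y) re≡ , ≈ᴿ-termwise (im x) (im y) im≡

≈-isEquivalence : IsEquivalence _≈_
≈-isEquivalence = record
  { refl  = λ {x} → ≈-termwise x x (λ _ → refl) (λ _ → refl)
  ; sym   = λ {x} {y} (r , i) → ≈ᴿ-sym (re x) (re y) r , ≈ᴿ-sym (im x) (im y) i
  ; trans = λ {x} {y} {z} (r , i) (r′ , i′) →
      ≈ᴿ-trans (re x) (re y) (re z) r r′ , ≈ᴿ-trans (im x) (im y) (im z) i i′
  }

≈-setoid : Setoid 0ℓ 0ℓ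
≈-setoid = record { isEquivalence = ≈-isEquivalence }

+-cong : Congruent₂ _≈_ _+_
+-cong {x} {x′} {y} {y′} (r , i) (r′ , i′) =
  +ᴿ-cong (re x) (re x′) (re y) (re y′) r r′ , +ᴿ-cong (im x) (im x′) (im y) (im y′) i i′

-‿cong : Congruent₁ _≈_ (-_)
-‿cong {x} {x′} (r , i) = -ᴿ-cong (re x) (re x′) r , -ᴿ-cong (im x) (im x′) i

*-cong : Congruent₂ _≈_ _*_
*-cong {x} {x′} {y} {y′} (r , i) (r′ , i′) =
  +ᴿ-cong (re x *ᴿ re y) (re x′ *ᴿ re y′) (-ᴿ (im x *ᴿ im y)) (-ᴿ (im x′ *ᴿ im y′))
    (*ᴿ-cong (re x) (re x′) (re y) (re y′) r r′)
    (-ᴿ-cong (im x *ᴿ im y) (im x′ *ᴿ im y′) (*ᴿ-cong (im x) (im x′) (im y) (im y′) i i′)) ,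
  +ᴿ-cong (re x *ᴿ im y) (re x′ *ᴿ im y′) (im x *ᴿ re y) (im x′ *ᴿ re y′)
    (*ᴿ-cong (re x) (re x′) (im y) (im y′) r i′)
    (*ᴿ-cong (im x) (im x′) (re y) (re y′) i r′)

-- The operations act termwise on rational sequences, so this law and the ring laws after it are
-- polynomial identities over `ℚ` at each index.
*-comm : ∀ x y → x * y ≈ y * x
*-comm x y = ≈-termwise (x * y) (y * x)
  (λ n → solve 4 (λ a b c d → a :* c :- b :* d := c :* a :- d :* b) refl
    (seq (re x) n) (seq (im x) n) (seq (re y) n) (seq (im y) n))
  (λ n → solve 4 (λ a b c d → a :* d :+ b :* c := c :* b :+ d :* a) refl
    (seq (re x) n) (seq (im x) n) (seq (re y) n) (seq (im y) n))
  where open +-*-Solver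

*-assoc : ∀ x y z → (x * y) * z ≈ x * (y * z)
*-assoc x y z = ≈-termwise ((x * y) * z) (x * (y * z))
  (λ n → solve 6 (λ a b c d e f →
      (a :* c :- b :* d) :* e :- (a :* d :+ b :* c) :* f :=
      a :* (c :* e :- d :* f) :- b :* (c :* f :+ d :* e)) refl
    (seq (re x) n) (seq (im x) n) (seq (re y) n) (seq (im y) n) (seq (re z) n) (seq (im z) n))
  (λ n → solve 6 (λ a b c d e f →
      (a :* c :- b :* d) :* f :+ (a :* d :+ b :* c) :* e :=
      a :* (c :* f :+ d :* e) :+ b :* (c :* e :- d :* f)) refl
    (seq (re x) n) (seq (im x) n) (seq (re y) n) (seq (im y) n) (seq (re z) n) (seq (im z) n))
  where open +-*-Solver

*-identityˡ : ∀ x → 1ℂ * x ≈ x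
*-identityˡ x = ≈-termwise (1ℂ * x) x
  (λ n → solve 2 (λ a b → con 1ℚ :* a :- con 0ℚ :* b := a) refl
    (seq (re x) n) (seq (im x) n))
  (λ n → solve 2 (λ a b → con 1ℚ :* b :+ con 0ℚ :* a := b) refl
    (seq (re x) n) (seq (im x) n))
  where open +-*-Solver

*-distribˡ-+ : ∀ x y z → x * (y + z) ≈ x * y + x * z
*-distribˡ-+ x y z = ≈-termwise (x * (y + z)) (x * y + x * z)
  (λ n → solve 6 (λ a b c d e f →
      a :* (c :+ e) :- b :* (d :+ f) := (a :* c :- b :* d) :+ (a :* e :- b :* f)) refl
    (seq (re x) n) (seq (im x) n) (seq (re y) n) (seq (im y) n) (seq (re z) n) (seq (im z) n))
  (λ n → solve 6 (λ a b c d e f →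
      a :* (d :+ f) :+ b :* (c :+ e) := (a :* d :+ b :* c) :+ (a :* f :+ b :* e)) refl
    (seq (re x) n) (seq (im x) n) (seq (re y) n) (seq (im y) n) (seq (re z) n) (seq (im z) n))
  where open +-*-Solver

isCommutativeRing : IsCommutativeRing _≈_ _+_ _*_ (-_) 0ℂ 1ℂ
isCommutativeRing = record
  { isRing = record
    { +-isAbelianGroup = record
      { isGroup = record
        { isMonoid = record
          { isSemigroup = record
            { isMagma = record
              { isEquivalence = ≈-isEquivalence
              ; ∙-cong        = λ {x} {x′} {y} {y′} → +-cong {x} {x′} {y} {y′}
              }
            ; assoc = λ x y z → ≈-termwise ((x + y) + z) (x + (y + z))
                (λ n → ℚ.+-assoc (seq (re x) n) (seq (re y) n) (seq (re z) n))
                (λ n → ℚ.+-assoc (seq (im x) n) (seq (im y) n) (seq (im z) n))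
            }
          ; identity =
              (λ x → ≈-termwise (0ℂ + x) x
                (λ n → ℚ.+-identityˡ (seq (re x) n)) (λ n → ℚ.+-identityˡ (seq (im x) n))) ,
              (λ x → ≈-termwise (x + 0ℂ) x
                (λ n → ℚ.+-identityʳ (seq (re x) n)) (λ n → ℚ.+-identityʳ (seq (im x) n)))
          }
        ; inverse =
            (λ x → ≈-termwise (- x + x) 0ℂ
              (λ n → ℚ.+-inverseˡ (seq (re x) n)) (λ n → ℚ.+-inverseˡ (seq (im x) n))) ,
            (λ x → ≈-termwise (x - x) 0ℂ
              (λ n → ℚ.+-inverseʳ (seq (re x) n)) (λ n → ℚ.+-inverseʳ (seq (im x) n)))
        ; ⁻¹-cong = λ {x} {y} → -‿cong {x} {y}
        }
      ; comm = λ x y → ≈-termwise (x + y) (y + x)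
          (λ n → ℚ.+-comm (seq (re x) n) (seq (re y) n))
          (λ n → ℚ.+-comm (seq (im x) n) (seq (im y) n))
      }
    ; *-cong     = λ {x} {x′} {y} {y′} → *-cong {x} {x′} {y} {y′}
    ; *-assoc    = *-assoc
    ; *-identity = comm∧idˡ⇒id {_∙_ = _*_} *-comm {e = 1ℂ} *-identityˡ
    ; distrib    = comm∧distrˡ⇒distr {_∙_ = _*_} {_◦_ = _+_}
        (λ {x} {x′} {y} {y′} → +-cong {x} {x′} {y} {y′}) *-comm *-distribˡ-+
    }
  ; *-comm = *-comm
  }
  where
  open import Algebra.Consequences.Setoid ≈-setoid
    using (comm∧idˡ⇒id; comm∧distrˡ⇒distr)

ℂ-commutativeRing : CommutativeRing 0ℓ 0ℓ
ℂ-commutativeRing = record { isCommutativeRing = isCommutativeRing }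

-- Complex inverses and the nonvanishing of 1 - z P(1) near zero.

*-inverseʳ : ∀ x (x#0 : x #0) → x * inv x x#0 ≈ 1ℂ
*-inverseʳ x x#0@(δ , 0<δ , N , δ≤) =
  -- The real part is a term of `normSq x` times its `recip`. As `recip` sends 0 to 0, this is known
  -- to be 1 only from `N` on, where the term is at least `δ`. The imaginary part cancels at every
  -- index.
  ≈ᴿ-eventually (re (x * inv x x#0)) 1ᴿ N (λ n n≥N → trans
    (solve 3 (λ a b r → a :* (a :* r) :- b :* (:- b :* r) := (a :* a :+ b :* b) :* r) refl
      (seq (re x) n) (seq (im x) n) (recip (seq (normSq x) n)))
    (p*recip[p]≡1 (ℚ.<-≤-trans 0<δ
      (subst (ℚ._≤ seq (normSq x) n) (ℚ.+-identityˡ δ) (δ≤ n n≥N))))) ,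
  ≈ᴿ-termwise (im (x * inv x x#0)) 0ᴿ (λ n →
    solve 3 (λ a b r → a :* (:- b :* r) :+ b :* (a :* r) := con 0ℚ) refl
      (seq (re x) n) (seq (im x) n) (recip (seq (normSq x) n)))
  where open +-*-Solver

-- With u = z * p, |1 - u|² = ½ - |u|² + 2 (Re u - ½)² + 2 (Im u)², so |1 - u|² ≥ ¼
-- as soon as |u|² = |z|² |p|² ≤ ¼, for which |p|² ≤ B and |z| ≤ 1/(2B) with B ≥ 1 suffice.
1-zp#0 : ∀ p → ∃[ ε ] 0ᴿ <ᴿ ε × (∀ z → ∣ z ∣< ε → (1ℂ - z * p) #0)
1-zp#0 p = fromℚ e , (e , 0<e , 0 , λ _ _ → ℚ.≤-reflexive (ℚ.+-identityˡ e)) , apart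
  where
  open +-*-Solver

  ¼ B e : ℚ
  ¼ = ½ ℚ.* ½
  B = proj₁ (bounded (normSq p))
  e = ½ ℚ.* recip B

  1≤B : 1ℚ ℚ.≤ B
  1≤B = proj₁ (proj₂ (bounded (normSq p)))

  0<B : 0ℚ ℚ.< B
  0<B = ℚ.<-≤-trans 0<1 1≤B

  0<e : 0ℚ ℚ.< e
  0<e = *-pos (toWitness {a? = 0ℚ ℚ.<? ½} _) (recip-pos 0<B)

  eB≡½ : e ℚ.* B ≡ ½
  eB≡½ = begin-equality
    ½ ℚ.* recip B ℚ.* B
      ≡⟨ solve 2 (λ b r → con ½ :* r :* b := con ½ :* (b :* r)) refl B (recip B) ⟩
    ½ ℚ.* (B ℚ.* recip B)
      ≡⟨ cong (½ ℚ.*_) (p*recip[p]≡1 0<B) ⟩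
    ½ ∎

  e≤½ : e ℚ.≤ ½
  e≤½ = begin
    e          ≡⟨ ℚ.*-identityʳ e ⟨
    e ℚ.* 1ℚ   ≤⟨ ℚ.*-monoˡ-≤-nonNeg e ⦃ ℚ.nonNegative (ℚ.<⇒≤ 0<e) ⦄ 1≤B ⟩
    e ℚ.* B    ≡⟨ eB≡½ ⟩
    ½          ∎

  0≤normSq : ∀ z n → 0ℚ ℚ.≤ seq (normSq z) n
  0≤normSq z n = ℚ.+-mono-≤ (0≤p*p (seq (re z) n)) (0≤p*p (seq (im z) n))

  apart : ∀ z → ∣ z ∣< fromℚ e → (1ℂ - z * p) #0
  apart z (δ , 0<δ , M , z<e) =
    let _ , _ , N , p≤B = bounded (normSq p)
    in ¼ , toWitness {a? = 0ℚ ℚ.<? ¼} _ , M ℕ.⊔ N , λ n n≥ →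
    let a = seq (re z) n
        b = seq (im z) n
        c = seq (re p) n
        d = seq (im p) n
        z² = seq (normSq z) n
        p² = seq (normSq p) n
        u = a ℚ.* c ℚ.- b ℚ.* d
        v = a ℚ.* d ℚ.+ b ℚ.* c
        z²≤e² : z² ℚ.≤ e ℚ.* e
        z²≤e² = begin
          z²          ≡⟨ ℚ.+-identityʳ z² ⟨
          z² ℚ.+ 0ℚ   ≤⟨ ℚ.+-monoʳ-≤ z² (ℚ.<⇒≤ 0<δ) ⟩
          z² ℚ.+ δ    ≤⟨ z<e n (ℕ.m⊔n≤o⇒m≤o M N n≥) ⟩
          e ℚ.* e     ∎
        p²≤B : p² ℚ.≤ B
        p²≤B = subst (ℚ._≤ B) (ℚ.0≤p⇒∣p∣≡p (0≤normSq p n)) (p≤B n (ℕ.m⊔n≤o⇒n≤o M N n≥))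
        z²p²≤¼ : z² ℚ.* p² ℚ.≤ ¼
        z²p²≤¼ = begin
          z² ℚ.* p²
            ≤⟨ ℚ.*-monoʳ-≤-nonNeg p² ⦃ ℚ.nonNegative (0≤normSq p n) ⦄ z²≤e² ⟩
          e ℚ.* e ℚ.* p²
            ≡⟨ ℚ.*-assoc e e p² ⟩
          e ℚ.* (e ℚ.* p²)
            ≤⟨ ℚ.*-monoˡ-≤-nonNeg e ⦃ ℚ.nonNegative (ℚ.<⇒≤ 0<e) ⦄
                 (ℚ.*-monoˡ-≤-nonNeg e ⦃ ℚ.nonNegative (ℚ.<⇒≤ 0<e) ⦄ p²≤B) ⟩
          e ℚ.* (e ℚ.* B)
            ≡⟨ cong (e ℚ.*_) eB≡½ ⟩
          e ℚ.* ½
            ≤⟨ ℚ.*-monoʳ-≤-nonNeg ½ e≤½ ⟩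
          ¼ ∎
    in begin
    0ℚ ℚ.+ ¼
      ≡⟨⟩
    -- Here ¼ takes the shape of the identity for |1 - u|², with `z² * p²` at its bound ¼ and both
    -- squares at 0.
    ½ ℚ.- ¼ ℚ.+ (0ℚ ℚ.+ 0ℚ)
      ≤⟨ ℚ.+-mono-≤ (ℚ.+-monoʳ-≤ ½ (ℚ.neg-antimono-≤ z²p²≤¼))
           (ℚ.+-mono-≤ (twice (0≤p*p (u ℚ.- ½))) (twice (0≤p*p v))) ⟩
    ½ ℚ.- z² ℚ.* p² ℚ.+ (𝟚 ℚ.* ((u ℚ.- ½) ℚ.* (u ℚ.- ½)) ℚ.+ 𝟚 ℚ.* (v ℚ.* v))
      ≡⟨ solve 4 (λ a b c d →
           let u = a :* c :- b :* d
               v = a :* d :+ b :* c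
           in con ½ :- (a :* a :+ b :* b) :* (c :* c :+ d :* d)
                :+ (con 𝟚 :* ((u :- con ½) :* (u :- con ½)) :+ con 𝟚 :* (v :* v)) :=
              (con 1ℚ :- u) :* (con 1ℚ :- u) :+ (con 0ℚ :- v) :* (con 0ℚ :- v)) refl a b c d ⟩
    seq (normSq (1ℂ - z * p)) n ∎
    where
    𝟚 : ℚ
    𝟚 = 1ℚ ℚ.+ 1ℚ
    twice : ∀ {q} → 0ℚ ℚ.≤ q → 0ℚ ℚ.≤ 𝟚 ℚ.* q
    twice 0≤q = ℚ.*-monoˡ-≤-nonNeg 𝟚 0≤q

-- Integer powers of complex numbers and the family of solutions.

open CharacteristicRoots ℂ-commutativeRing

-- Both sides compute only once the sign of `k` is known, so the exponent laws have to be carried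
-- over along this equation.
zpow≡^[inv] : ∀ x x#0 k → zpow x x#0 k ≡ x ^[ inv x x#0 ] k
zpow≡^[inv] x x#0 (+ n)    = refl
zpow≡^[inv] x x#0 -[1+ n ] = refl

zpow-homo-* : ∀ x x#0 j k → zpow x x#0 (+ j ℤ.+ k) ≈ zpow x x#0 (+ j) * zpow x x#0 k
zpow-homo-* x x#0 j k rewrite zpow≡^[inv] x x#0 (+ j ℤ.+ k) | zpow≡^[inv] x x#0 k =
  ^[]-homo-* {x} {inv x x#0} (*-inverseʳ x x#0) j k

-- Negative exponents go through `inv 1ℂ 1#0`, which is 1 because its product with `1ℂ` equals both
-- itself and 1.
zpow-1 : ∀ k → zpow 1ℂ 1#0 k ≈ 1ℂ
zpow-1 k rewrite zpow≡^[inv] 1ℂ 1#0 k = 1^[1] {1ℂ} {inv 1ℂ 1#0} (≈-refl {1ℂ})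
  (≈-trans {inv 1ℂ 1#0} {1ℂ * inv 1ℂ 1#0} {1ℂ}
    (≈-sym {1ℂ * inv 1ℂ 1#0} {inv 1ℂ 1#0} (*-identityˡ (inv 1ℂ 1#0))) (*-inverseʳ 1ℂ 1#0)) k
  where open IsEquivalence ≈-isEquivalence
          renaming (refl to ≈-refl; sym to ≈-sym; trans to ≈-trans)

theorem3 :
    ∀ (m : ℕ) (b : Fin m → ℤ) → Injective _≡_ _≡_ b →
    ∀ (w : Fin m → ℝ) → (∀ ℓ → 0ᴿ <ᴿ w ℓ) →
    ∀ (c : ℕ) → 1 ℕ.≤ c → IsMin b (ℤ.- (+ c)) →
    ∀ (S : SmallSolutions b w c) → let open SmallSolutions S in
    ∃[ ε ] 0ᴿ <ᴿ ε ×
      (∀ (z : PuncturedDisc radius) → ∣ value z ∣< ε →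
       Σ[ d ∈ (1ℂ - value z * P b w 1ℂ 1#0) #0 ]
         (∀ (α : Fin c → ℂ) (T : ℤ → ℂ) →
          (∀ (j : ℤ) → ℤ.- (+ c) ℤ.≤ j →
             T j ≈ inv (1ℂ - value z * P b w 1ℂ 1#0) d
                     * (1ℂ - sum (λ ℓ → α ℓ * zpow (X z ℓ) (X#0 z ℓ) j))) →
          SolvesRecurrence b w (value z) T))
theorem3 m b _ w _ c _ (-c≤b , _) S =
  let p               = P b w 1ℂ 1#0
      ε , 0<ε , apart = 1-zp#0 p
  -- `ε` depends on P(1) alone and only keeps 1 - z P(1) invertible; that the roots exist at `z` is
  -- already part of `z` being a point of the punctured disc of `S`.
  in ε , 0<ε , λ z z<ε →
  let d = apart (value z) z<ε
      D = 1ℂ - value z * p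
  in d , λ α T T≈ j →
  recurrence-at (value z) p (inv D d) (λ ℓ → ofℝ (w ℓ)) b
    α (λ k → zpow (X z k) (X#0 z k)) (λ k → zpow-homo-* (X z k) (X#0 z k))
    {λ ℓ → zpow 1ℂ 1#0 (b ℓ)} T j
    -- P(1) is by definition the weighted sum of integer powers of 1, and `X-solves` states the
    -- characteristic equation in the very form of `char`.
    (IsEquivalence.refl ≈-isEquivalence {p}) (λ ℓ → zpow-1 (b ℓ)) (*-inverseʳ D d) (X-solves z)
    (T≈ (+ j) (ℤ.neg-≤-pos {c} {j}))
    (λ ℓ → T≈ (+ j ℤ.+ b ℓ) (ℤ.≤-trans (-c≤b ℓ) (ℤ.i≤j+i (b ℓ) (+ j))))
  where open SmallSolutions S
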